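{- Let $(a(n))_{n\ge 1}$ be the sequence of positive integers defined by $a(1)=1$, $a(2)=2$, $a(3)=3$, and, for $n\ge 4$, $a(n)$ is the smallest positive integer $m$ such that $m\notin\{a(1),\dots,a(n-1)\}$, $\gcd(m,a(n-2))>1$ and $\gcd(m,a(n-1))=1$. Then $(a(n))_{n\ge 1}$ is a permutation of the natural numbers (positive integers); that is, the map $n\mapsto a(n)$ is a bijection from $\{1,2,3,\dots\}$ to itself.
   Context: Natural numbers here means positive integers. Two integers "have a common factor" when their greatest common divisor is greater than $1$. The sequence is called the Yellowstone permutation (OEIS A098550) and begins $1,2,3,4,9,8,15,14,5,6,25,12,35,16,7,\dots$. -}

module Defs where

open import Data.Irrelevant using ([_])
open import Data.Nat
open import Data.Nat.GCD using (gcd)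
open import Data.Product using (_×_)
open import Data.Refinement using (Refinement-syntax; value; _,_)
open import Relation.Binary.PropositionalEquality using (_≡_; _≢_)
open import Relation.Unary using (Pred)
open import Level using (0ℓ)

-- The proof component is irrelevant, so two elements with the same value
-- are propositionally equal.
ℕ⁺ : Set
ℕ⁺ = [ n ∈ ℕ ∣ NonZero n ]

pos : (n : ℕ) → .{{NonZero n}} → ℕ⁺
pos n {{n≢0}} = n , [ n≢0 ]

IsLeast : Pred ℕ⁺ 0ℓ → Pred ℕ⁺ 0ℓ
IsLeast P m = P m × (∀ m′ → P m′ → value m ≤ value m′)

-- Indices are shifted to avoid truncated subtraction: with n = 4 + k, the
-- terms a(n-1) and a(n-2) are a(3 + k) and a(2 + k).
record Candidate (a : ℕ⁺ → ℕ⁺) (k : ℕ) (m : ℕ⁺) : Set where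
  field
    unused  : ∀ i → value i < 4 + k → m ≢ a i
    shares  : gcd (value m) (value (a (pos (2 + k)))) > 1
    coprime : gcd (value m) (value (a (pos (3 + k)))) ≡ 1

record IsYellowstone (a : ℕ⁺ → ℕ⁺) : Set where
  field
    first  : a (pos 1) ≡ pos 1
    second : a (pos 2) ≡ pos 2
    third  : a (pos 3) ≡ pos 3
    next   : ∀ k → IsLeast (Candidate a k) (a (pos (4 + k)))

{-# OPTIONS --safe #-}

-- A power of a(n-2) exceeding all earlier terms is always a candidate, so the
-- sequence exists, and no term repeats. By minimality, infinitely many primes
-- divide terms: if a(n) > p² and a prime s < p divides a(n-2) and a(n), then
-- s p would have been chosen before a(n), unless p divides a term. Replacing a
-- large prime factor q of a(n) by a power of p below q shows in the same way
-- that every prime p divides infinitely many terms. A number m that shares a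
-- factor with a(n-2) and is coprime to a(n-1) for infinitely many n must occur,
-- as otherwise a(n) ≤ m for infinitely many n. Hence every prime occurs, and
-- then every m > 1 occurs: infinitely many terms share a factor with m, while
-- the large primes among the terms are coprime to m.
module Submission where

open import Defs
open import Data.Product using (_×_; ∃-syntax)
open import Function.Definitions using (Bijective)
open import Relation.Binary.PropositionalEquality using (_≡_)

open import Data.Empty using (⊥-elim-irr)
open import Data.Irrelevant using ([_])
open import Data.List using (List; []; _∷_; applyDownFrom)
open import Data.List.Membership.DecPropositional using (_∈?_)
open import Data.List.Membership.Propositional using (_∈_; _∉_)
open import Data.List.Membership.Propositional.Properties
  using (∈-applyDownFrom⁺; ∈-applyDownFrom⁻)
open import Data.List.Relation.Unary.All using (All; []; _∷_)
open import Data.List.Relation.Unary.Any using (here; there)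
open import Data.Nat
open import Data.Nat.Coprimality
  using (Coprime; coprime?; prime⇒coprime; 1-coprimeTo; coprime⇒gcd≡1; gcd≡1⇒coprime;
         coprime-divisor)
  renaming (sym to coprime-sym)
open import Data.Nat.Divisibility
open import Data.Nat.GCD
open import Data.Nat.Induction using (<-rec)
open import Data.Nat.ListAction using (product; sum)
open import Data.Nat.Primality
open import Data.Nat.Primality.Factorisation using (factorise; PrimeFactorisation)
open import Data.Nat.Properties
open import Data.Product using (_,_; proj₁; proj₂)
open import Data.Refinement using (value; value-injective; _,_)
open import Data.Sum using (_⊎_; inj₁; inj₂)
open import Function using (_∘_)
open import Relation.Binary.Definitions using (tri<; tri≈; tri>)
open import Relation.Binary.PropositionalEquality
  using (_≢_; refl; sym; trans; cong; cong₂; subst)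
open import Relation.Nullary using (¬_; yes; no; contradiction)
open import Relation.Nullary.Decidable using (_×-dec_; ¬?; decidable-stable)
open import Relation.Unary using (Decidable)

private
  variable
    d m n o p q : ℕ

-- Decidable search, bounds and growth of powers.

least : {P : ℕ → Set} → Decidable P → ∀ n → P n →
        ∃[ m ] P m × (∀ i → P i → m ≤ i)
least {P} P? = <-rec _ λ n rec Pn → search n rec Pn (anyUpTo? P? n)
  where
  Least = ∃[ m ] P m × (∀ i → P i → m ≤ i)
  search : ∀ n → (∀ {i} → i < n → P i → Least) → P n → _ → Least
  search n rec Pn (yes (i , i<n , Pi)) = rec i<n Pi
  search n rec Pn (no none) =
    n , Pn , λ i Pi → ≮⇒≥ λ i<n → none (i , i<n , Pi)

-- Descending from a failure of `P`, the first success met has a failure just above it; the descent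
-- reaches `n` at the latest.
lastBefore : {P : ℕ → Set} → Decidable P → ∀ d n → P n → ¬ P (d + n) →
             ∃[ m ] n ≤ m × P m × ¬ P (suc m)
lastBefore P? zero    n Pn ¬Pn = contradiction Pn ¬Pn
lastBefore P? (suc d) n Pn ¬P  with P? (d + n)
... | yes P = d + n , m≤n+m n d , P , ¬P
... | no ¬P′ = lastBefore P? d n Pn ¬P′

upperBound : ∀ (f : ℕ → ℕ) n → ∃[ B ] (∀ i → i < n → f i ≤ B)
upperBound f zero = 0 , λ _ ()
upperBound f (suc n) with upperBound f n
... | B , f≤B = f n ⊔ B , bound
  where
  bound : ∀ i → i < suc n → f i ≤ f n ⊔ B
  bound i i<1+n with m<1+n⇒m<n∨m≡n i<1+n
  ... | inj₁ i<n  = ≤-trans (f≤B i i<n) (m≤n⊔m (f n) B)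
  ... | inj₂ refl = m≤m⊔n (f n) B

n<m^n : ∀ m n → 1 < m → n < m ^ n
n<m^n m zero    1<m = s≤s z≤n
n<m^n m (suc n) 1<m = begin-strict
  suc n         ≤⟨ n<m^n m n 1<m ⟩
  m ^ n         <⟨ m<m*n (m ^ n) m {{>-nonZero (≤-trans (s≤s z≤n) (n<m^n m n 1<m))}} 1<m ⟩
  m ^ n * m     ≡⟨ *-comm (m ^ n) m ⟩
  m * m ^ n     ∎
  where open ≤-Reasoning

∈⇒≤sum : ∀ {x} xs → x ∈ xs → x ≤ sum xs
∈⇒≤sum (x ∷ xs) (here refl) = m≤m+n x (sum xs)
∈⇒≤sum (x ∷ xs) (there x∈)  = ≤-trans (∈⇒≤sum xs x∈) (m≤n+m (sum xs) x)

-- Common factors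

prime>1 : Prime p → 1 < p
prime>1 {p} pp = nonTrivial⇒n>1 p {{prime⇒nonTrivial pp}}

prime>0 : Prime p → 0 < p
prime>0 = <⇒≤ ∘ prime>1

primeDivisor : 1 < n → ∃[ p ] Prime p × p ∣ n
primeDivisor {n@(suc _)} 1<n = divisor factors isFactorisation factorsPrime
  where
  open PrimeFactorisation (factorise n)
  divisor : ∀ ps → n ≡ product ps → All Prime ps → ∃[ p ] Prime p × p ∣ n
  divisor []       refl _        = contradiction 1<n (n≮n 1)
  divisor (p ∷ ps) eq   (pp ∷ _) = p , pp , divides (product ps) (trans eq (*-comm p _))

commonPrime : ∀ m n → 1 < gcd m n → ∃[ p ] Prime p × p ∣ m × p ∣ n
commonPrime m n 1<g with primeDivisor 1<g
... | p , pp , p∣g =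
  p , pp , ∣-trans p∣g (gcd[m,n]∣m m n) , ∣-trans p∣g (gcd[m,n]∣n m n)

gcd>0 : ∀ m n → 0 < m → 0 < gcd m n
gcd>0 m n 0<m = n≢0⇒n>0 λ g≡0 → >⇒≢ 0<m (gcd[m,n]≡0⇒m≡0 g≡0)

¬coprime⇒gcd>1 : 0 < m → ¬ Coprime m n → 1 < gcd m n
¬coprime⇒gcd>1 {m} {n} 0<m ¬c = ≤∧≢⇒< (gcd>0 m n 0<m) (¬c ∘ gcd≡1⇒coprime ∘ sym)

commonPrime⇒¬coprime : Prime p → p ∣ m → p ∣ n → ¬ Coprime m n
commonPrime⇒¬coprime pp p∣m p∣n c = >⇒≢ (prime>1 pp) (c (p∣m , p∣n))

coprime-∣ˡ : m ∣ n → Coprime n o → Coprime m o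
coprime-∣ˡ m∣n c (d∣m , d∣o) = c (∣-trans d∣m m∣n , d∣o)

coprime-* : Coprime m o → Coprime n o → Coprime (m * n) o
coprime-* {m} {o} {n} cm cn {d} (d∣mn , d∣o) = cn (coprime-divisor d⊥m d∣mn , d∣o)
  where
  d⊥m : Coprime d m
  d⊥m (e∣d , e∣m) = cm (e∣m , ∣-trans e∣d d∣o)

coprime-^ : ∀ i → Coprime m n → Coprime (m ^ i) n
coprime-^ zero    c (d∣1 , _) = ∣1⇒≡1 d∣1
coprime-^ (suc i) c = coprime-* c (coprime-^ i c)

∤⇒coprime : Prime p → ¬ p ∣ n → Coprime p n
∤⇒coprime pp p∤n (d∣p , d∣n) with prime⇒irreducible pp d∣p
... | inj₁ d≡1  = d≡1
... | inj₂ refl = contradiction d∣n p∤n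

prime∣prime⇒≡ : Prime p → Prime q → p ∣ q → p ≡ q
prime∣prime⇒≡ pp pq p∣q with prime⇒irreducible pq p∣q
... | inj₁ refl = contradiction pp ¬prime[1]
... | inj₂ p≡q  = p≡q

∣-! : 0 < m → m ≤ n → m ∣ n !
∣-! {suc m} _ m≤n = ∣-trans (divides (m !) (*-comm (suc m) (m !))) (m≤n⇒m!∣n! m≤n)

-- Euclid's argument: a prime divisor of `n ! + 1` that is at most `n` would also divide `n !`,
-- hence 1.
primesUnbounded : ∀ n → ∃[ p ] Prime p × n < p
primesUnbounded n with primeDivisor {suc (n !)} (s≤s (n!>0 n))
  where
  n!>0 : ∀ n → 0 < n !
  n!>0 n = >-nonZero⁻¹ (n !) {{n !≢0}}
... | p , pp , p∣1+n! = p , pp , ≰⇒> λ p≤n →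
  >⇒≢ (prime>1 pp) (∣1⇒≡1
    (∣m+n∣m⇒∣n (subst (p ∣_) (+-comm 1 (n !)) p∣1+n!) (∣-! (prime>0 pp) p≤n)))

-- The sequence on natural numbers

-- The term b n is a(n + 1), so all indices are one less than in Defs.
record Candidateℕ (b : ℕ → ℕ) (k m : ℕ) : Set where
  field
    positive : 0 < m
    unused   : ∀ i → i < 3 + k → m ≢ b i
    shares   : 1 < gcd m (b (1 + k))
    coprime  : gcd m (b (2 + k)) ≡ 1

record IsYellowstoneℕ (b : ℕ → ℕ) : Set where
  field
    first    : b 0 ≡ 1
    second   : b 1 ≡ 2
    third    : b 2 ≡ 3
    next     : ∀ k → Candidateℕ b k (b (3 + k))
    smallest : ∀ k m → Candidateℕ b k m → b (3 + k) ≤ m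

module Yellowstone {b : ℕ → ℕ} (Y : IsYellowstoneℕ b) where

  open IsYellowstoneℕ Y

  private module Next k = Candidateℕ (next k)

  Appears : ℕ → Set
  Appears m = ∃[ n ] b n ≡ m

  positive : ∀ n → 0 < b n
  positive 0 = subst (0 <_) (sym first) (s≤s z≤n)
  positive 1 = subst (0 <_) (sym second) (s≤s z≤n)
  positive 2 = subst (0 <_) (sym third) (s≤s z≤n)
  positive (suc (suc (suc k))) = Next.positive k

  distinct : ∀ i j → i < j → b j ≢ b i
  distinct 0 1 _ eq with () ← trans (sym second) (trans eq first)
  distinct 0 2 _ eq with () ← trans (sym third) (trans eq first)
  distinct 1 2 _ eq with () ← trans (sym third) (trans eq second)
  distinct (suc _) 1 (s≤s ()) _
  distinct (suc (suc _)) 2 (s≤s (s≤s ())) _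
  distinct i (suc (suc (suc k))) i<j eq = Next.unused k i i<j eq

  injective : ∀ i j → b i ≡ b j → i ≡ j
  injective i j eq with <-cmp i j
  ... | tri< i<j _ _ = contradiction (sym eq) (distinct i j i<j)
  ... | tri≈ _ i≡j _ = i≡j
  ... | tri> _ _ j<i = contradiction eq (distinct j i j<i)

  adjacent : ∀ n → Coprime (b (suc n)) (b n)
  adjacent 0 = gcd≡1⇒coprime (cong₂ gcd second first)
  adjacent 1 = gcd≡1⇒coprime (cong₂ gcd third second)
  adjacent (suc (suc k)) = gcd≡1⇒coprime (Next.coprime k)

  -- A bounded search decides whether `m` occurred earlier; if not, `m` is a candidate and competes
  -- with `b (3 + k)`.
  minimal : ∀ k m → 0 < m → ¬ Coprime m (b (1 + k)) → Coprime m (b (2 + k)) →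
            Appears m ⊎ b (3 + k) ≤ m
  minimal k m 0<m ¬c c with anyUpTo? (λ i → b i ≟ m) (3 + k)
  ... | yes (i , _ , bi≡m) = inj₁ (i , bi≡m)
  ... | no none = inj₂ (smallest k m record
    { positive = 0<m
    ; unused   = λ i i<n m≡bi → none (i , i<n , sym m≡bi)
    ; shares   = ¬coprime⇒gcd>1 0<m ¬c
    ; coprime  = coprime⇒gcd≡1 c
    })

  -- The positive form of "b tends to infinity": a conclusion Q may be drawn
  -- even if the reason for it is only available at indices n with b n > B.
  escape : ∀ B {Q : Set} → (∀ N → (∃[ n ] N ≤ n × b n ≤ B) ⊎ Q) → Q
  escape zero often with often 0
  ... | inj₁ (n , _ , bn≤0) = contradiction (positive n) (≤⇒≯ bn≤0)
  ... | inj₂ Q = Q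
  escape (suc B) {Q} often = escape B below
    where
    below : ∀ N → (∃[ n ] N ≤ n × b n ≤ B) ⊎ Q
    below N with often N
    ... | inj₂ Q = inj₂ Q
    ... | inj₁ (n , N≤n , bn≤1+B) with m≤n⇒m<n∨m≡n bn≤1+B
    ... | inj₁ (s≤s bn≤B) = inj₁ (n , N≤n , bn≤B)
    -- The value `suc B` is taken at `n` and never again, so beyond `n` the bound `suc B` improves
    -- to `B`.
    ... | inj₂ bn≡1+B = inj₂ (escape B later)
      where
      later : ∀ M → (∃[ i ] M ≤ i × b i ≤ B) ⊎ Q
      later M with often (suc n ⊔ M)
      ... | inj₂ Q = inj₂ Q
      ... | inj₁ (i , ≤i , bi≤1+B) with m≤n⇒m<n∨m≡n bi≤1+B
      ... | inj₁ (s≤s bi≤B) = inj₁ (i , ≤-trans (m≤n⊔m (suc n) M) ≤i , bi≤B)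
      ... | inj₂ bi≡1+B =
        contradiction (trans bi≡1+B (sym bn≡1+B))
          (distinct n i (≤-trans (m≤m⊔n (suc n) M) ≤i))

  -- Whenever `m` is eligible, either it has been used or the chosen term is at most `m`; since
  -- terms are distinct, the latter cannot recur forever.
  oftenEligible⇒appears : 0 < m →
    (∀ N → ∃[ n ] N ≤ n × ¬ Coprime m (b n) × Coprime m (b (suc n))) → Appears m
  oftenEligible⇒appears {m} 0<m often = escape m bounded
    where
    bounded : ∀ N → (∃[ n ] N ≤ n × b n ≤ m) ⊎ Appears m
    -- Asking for `suc N` makes the index found a successor, the form `minimal` expects.
    bounded N with often (suc N)
    ... | suc n , s≤s N≤n , ¬c , c with minimal n m 0<m ¬c c
    ... | inj₁ appears = inj₂ appears
    ... | inj₂ b≤m     = inj₁ (3 + n , ≤-trans N≤n (m≤n+m n 3) , b≤m)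

  -- If b(n) > p² shares the prime s < p with b(n-2), then s p is a smaller
  -- candidate unless p divides b(n-1) or s p was used; either way p divides a term.
  largePrimeDivides : ∀ B → ∃[ q ] Prime q × B < q × (∃[ n ] q ∣ b n)
  largePrimeDivides B with primesUnbounded B
  ... | p , pp , B<p = escape (p * p) bounded
    where
    Goal = ∃[ q ] Prime q × B < q × (∃[ n ] q ∣ b n)
    bounded : ∀ N → (∃[ n ] N ≤ n × b n ≤ p * p) ⊎ Goal
    bounded N with b (3 + N) ≤? p * p
    ... | yes small = inj₁ (3 + N , m≤n+m N 3 , small)
    ... | no large with commonPrime (b (3 + N)) (b (1 + N)) (Next.shares N)
    ... | s , ps , s∣₃ , s∣₁ with p ≤? s
    -- Here `s` itself is a prime above `B` dividing a term.
    ... | yes p≤s = inj₂ (s , ps , <-≤-trans B<p p≤s , 3 + N , s∣₃)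
    ... | no p≰s with p ∣? b (2 + N)
    ... | yes p∣₂ = inj₂ (p , pp , B<p , 2 + N , p∣₂)
    ... | no p∤₂ with minimal N (s * p)
                        (*-mono-< (prime>0 ps) (prime>0 pp))
                        (commonPrime⇒¬coprime ps (m∣m*n p) s∣₁)
                        (coprime-* (coprime-∣ˡ s∣₃ (adjacent (2 + N))) (∤⇒coprime pp p∤₂))
    ... | inj₁ (i , bi≡sp) = inj₂ (p , pp , B<p , i , divides s bi≡sp)
    ... | inj₂ b≤sp = contradiction (≤-trans b≤sp (*-monoˡ-≤ p (≰⇒≥ p≰s))) large

  -- If b(n) = k q and q does not divide b(n-2), then k shares a factor with
  -- b(n-2), so k p^i < k q is a candidate unless p divides b(n-1) or k p^i was used.
  replacePrime : ∀ i → Prime p → Prime q → p ^ i < q →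
                 ∀ M → q ∣ b (3 + M) → ¬ q ∣ b (1 + M) →
                 p ∣ b (2 + M) ⊎ (∃[ j ] p ^ i ∣ b j)
  replacePrime {p} {q} i pp pq r<q M (divides k bn≡kq) q∤₁
    with commonPrime (b (3 + M)) (b (1 + M)) (Next.shares M)
  ... | s , ps , s∣₃ , s∣₁ with p ∣? b (2 + M)
  ... | yes p∣₂ = inj₁ p∣₂
  ... | no p∤₂ with euclidsLemma k q ps (subst (s ∣_) bn≡kq s∣₃)
  -- If `s` divided `q`, it would equal `q` and `q` would divide `b (1 + M)`; so `s` comes from the
  -- cofactor `k`.
  ... | inj₂ s∣q = contradiction (subst (_∣ b (1 + M)) (prime∣prime⇒≡ ps pq s∣q) s∣₁) q∤₁
  ... | inj₁ s∣k = inj₂ (conclude (minimal M (k * p ^ i)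
                     (*-mono-< 0<k (m^n>0 p {{prime⇒nonZero pp}} i))
                     (commonPrime⇒¬coprime ps (∣-trans s∣k (m∣m*n (p ^ i))) s∣₁)
                     (coprime-* (coprime-∣ˡ k∣bn (adjacent (2 + M)))
                                (coprime-^ i (∤⇒coprime pp p∤₂)))))
    where
    0<k : 0 < k
    0<k = n≢0⇒n>0 λ { refl → >⇒≢ (positive (3 + M)) bn≡kq }

    k∣bn : k ∣ b (3 + M)
    k∣bn = divides q (trans bn≡kq (*-comm k q))

    conclude : Appears (k * p ^ i) ⊎ b (3 + M) ≤ k * p ^ i → ∃[ j ] p ^ i ∣ b j
    conclude (inj₁ (j , bj≡kr)) = j , divides k bj≡kr
    conclude (inj₂ b≤kr) = contradiction (subst (_≤ k * p ^ i) bn≡kq b≤kr)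
      (<⇒≱ (*-monoʳ-< k {{>-nonZero 0<k}} r<q))

  -- Left transparent, this lemma unfolds to the whole prime search at every use.
  abstract

    -- Apply replacePrime to the first multiple of some prime q > r, where the
    -- power r of p exceeds b(i) for all i < N + 3, so that q and r only divide
    -- later terms.
    multiplesRecur : Prime p → ∀ N → ∃[ n ] N ≤ n × p ∣ b n
    multiplesRecur {p} pp N = fromBound (upperBound b (3 + N))
      where
      fromBound : ∃[ B ] (∀ i → i < 3 + N → b i ≤ B) → ∃[ n ] N ≤ n × p ∣ b n
      fromBound (B , b≤B) = fromPrime (largePrimeDivides (p ^ suc B))
        where
        -- The exponent `suc B` makes the power exceed `B` and unfold to `p * p ^ B`, a multiple of
        -- `p`.
        B<r : B < p ^ suc B
        B<r = <⇒≤ (n<m^n p (suc B) (prime>1 pp))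

        late : ∀ {i d} → p ^ suc B ≤ d → d ∣ b i → 3 + N ≤ i
        late {i} r≤d d∣bi = ≮⇒≥ λ i<3+N → <⇒≱ (<-≤-trans B<r r≤d)
          (≤-trans (∣⇒≤ {{>-nonZero (positive i)}} d∣bi) (b≤B i i<3+N))

        fromPrime : ∃[ q ] Prime q × p ^ suc B < q × (∃[ n ] q ∣ b n) →
                    ∃[ n ] N ≤ n × p ∣ b n
        fromPrime (q , pq , r<q , n , q∣bn) = fromFirst (least (λ i → q ∣? b i) n q∣bn)
          where
          fromFirst : ∃[ n ] q ∣ b n × (∀ i → q ∣ b i → n ≤ i) → ∃[ n ] N ≤ n × p ∣ b n
          fromFirst (n , q∣bn , q-first) with late (<⇒≤ r<q) q∣bn
          -- By `late` the index is at least 3, so a term two places earlier exists; `q` does not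
          -- divide it because the index is the first.
          fromFirst (suc (suc (suc M)) , q∣bn , q-first) | s≤s (s≤s (s≤s N≤M))
            with replacePrime (suc B) pp pq r<q M q∣bn
                   (λ q∣₁ → <⇒≱ (m≤n+m (2 + M) 1) (q-first (1 + M) q∣₁))
          ... | inj₁ p∣₂ = 2 + M , ≤-trans N≤M (m≤n+m M 2) , p∣₂
          ... | inj₂ (j , r∣bj) =
            j , ≤-trans (m≤n+m N 3) (late ≤-refl r∣bj) , ∣-trans (m∣m*n (p ^ B)) r∣bj

  -- A multiple of `p` is followed by a term coprime to it, hence to `p`, so `p` is eligible after
  -- each of its infinitely many multiples.
  prime-appears : Prime p → Appears p
  prime-appears {p} pp = oftenEligible⇒appears (prime>0 pp) often
    where
    often : ∀ N → ∃[ n ] N ≤ n × ¬ Coprime p (b n) × Coprime p (b (suc n))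
    often N with multiplesRecur pp N
    ... | n , N≤n , p∣bn = n , N≤n , commonPrime⇒¬coprime pp ∣-refl p∣bn ,
      coprime-∣ˡ p∣bn (coprime-sym (adjacent n))

  -- Beyond any N there is a large prime term, which is coprime to m.
  coprimesRecur : ∀ m → 0 < m → ∀ N → ∃[ n ] N ≤ n × Coprime m (b n)
  coprimesRecur m 0<m N with upperBound b N
  ... | B , b≤B with primesUnbounded (m ⊔ B)
  ... | p , pp , m⊔B<p with prime-appears pp
  ... | n , refl =
    n , ≮⇒≥ (λ n<N → <⇒≱ m⊔B<p (≤-trans (b≤B n n<N) (m≤n⊔m m B))) ,
    coprime-sym (prime⇒coprime pp {{>-nonZero 0<m}} (≤-<-trans (m≤m⊔n m B) m⊔B<p))

  -- Both terms sharing a factor with m and terms coprime to m recur, so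
  -- infinitely often a term of the first kind is followed by one of the second.
  appears : ∀ m → 0 < m → Appears m
  appears m 0<m with m≤n⇒m<n∨m≡n 0<m
  -- The number 1 shares no factor with any term; it occurs only as the initial value.
  ... | inj₂ refl = 0 , first
  ... | inj₁ 1<m  = fromPrime (primeDivisor 1<m)
    where
    fromPrime : ∃[ p ] Prime p × p ∣ m → Appears m
    fromPrime (p , pp , p∣m) = oftenEligible⇒appears 0<m often
      where
      often : ∀ N → ∃[ n ] N ≤ n × ¬ Coprime m (b n) × Coprime m (b (suc n))
      often N with multiplesRecur pp N
      ... | n , N≤n , p∣bn with coprimesRecur m 0<m n
      ... | n′ , n≤n′ , c
        with lastBefore (λ i → ¬? (coprime? m (b i))) (n′ ∸ n) n
               (commonPrime⇒¬coprime pp p∣m p∣bn)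
               (λ ¬c → ¬c (subst (λ i → Coprime m (b i)) (sym (m∸n+n≡m n≤n′)) c))
      ... | i , n≤i , ¬c , ¬¬c =
        i , ≤-trans N≤n n≤i , ¬c , decidable-stable (coprime? m (b (suc i))) ¬¬c

-- Existence

-- The invariants guarantee a next term; `current>1` is carried because `current` becomes `previous`
-- one step later.
record History : Set where
  field
    used        : List ℕ
    previous    : ℕ
    current     : ℕ
    previous>1  : 1 < previous
    current>1   : 1 < current
    consecutive : gcd current previous ≡ 1

Eligible : History → ℕ → Set
Eligible h m = 0 < m × m ∉ used × 1 < gcd m previous × gcd m current ≡ 1
  where open History h

eligible? : ∀ h → Decidable (Eligible h)
eligible? h m =
  0 <? m ×-dec ¬? (_∈?_ _≟_ m used) ×-dec 1 <? gcd m previous ×-dec gcd m current ≟ 1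
  where open History h

eligible-exists : ∀ h → ∃[ m ] Eligible h m
eligible-exists h = x ^ suc j , 0<m , m∉used , 1<g ,
    coprime⇒gcd≡1 {x ^ suc j} {current} (coprime-^ (suc j)
      (coprime-sym (gcd≡1⇒coprime {current} {x} consecutive)))
  where
  open History h renaming (previous to x)
  -- The sum bounds every used term, and the power with exponent `suc j` exceeds it.
  j = sum used

  j<m : j < x ^ suc j
  j<m = <⇒≤ (n<m^n x (suc j) previous>1)

  0<m : 0 < x ^ suc j
  0<m = ≤-trans (s≤s z≤n) j<m

  m∉used : x ^ suc j ∉ used
  m∉used m∈ = <⇒≱ j<m (∈⇒≤sum used m∈)

  1<g : 1 < gcd (x ^ suc j) x
  1<g = ¬coprime⇒gcd>1 0<m λ c → >⇒≢ previous>1 (c (m∣m*n (x ^ j) , ∣-refl))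

leastEligible : ∀ h → ∃[ m ] Eligible h m × (∀ i → Eligible h i → m ≤ i)
leastEligible h = least (eligible? h) (proj₁ (eligible-exists h)) (proj₂ (eligible-exists h))

extend : History → History
extend h with leastEligible h
... | m , (0<m , _ , 1<g , g≡1) , _ = record
  { used        = m ∷ used
  ; previous    = current
  ; current     = m
  ; previous>1  = current>1
  -- The value 1 is ruled out because its gcd with `previous` would be 1.
  ; current>1   = ≤∧≢⇒< 0<m (λ { refl → >⇒≢ 1<g (coprime⇒gcd≡1 (1-coprimeTo previous)) })
  ; consecutive = g≡1
  }
  where open History h

history : ℕ → History
history zero = record
  { used        = 3 ∷ 2 ∷ 1 ∷ []
  ; previous    = 2
  ; current     = 3
  ; previous>1  = s≤s (s≤s z≤n)
  ; current>1   = s≤s (s≤s z≤n)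
  ; consecutive = refl
  }
history (suc k) = extend (history k)

yellowstone : ℕ → ℕ
yellowstone 0 = 1
yellowstone 1 = 2
yellowstone (suc (suc k)) = History.current (history k)

used-history : ∀ k → History.used (history k) ≡ applyDownFrom yellowstone (3 + k)
used-history zero    = refl
used-history (suc k) = cong (yellowstone (3 + k) ∷_) (used-history k)

previous-history : ∀ k → History.previous (history k) ≡ yellowstone (1 + k)
previous-history zero    = refl
previous-history (suc k) = refl

yellowstone-eligible : ∀ k → Eligible (history k) (yellowstone (3 + k))
yellowstone-eligible k = proj₁ (proj₂ (leastEligible (history k)))

yellowstone-isYellowstone : IsYellowstoneℕ yellowstone
yellowstone-isYellowstone = record
  { first  = refl
  ; second = refl
  ; third  = refl
  ; next   = λ k → fromEligible k (yellowstone-eligible k)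
  ; smallest = λ k m c → proj₂ (proj₂ (leastEligible (history k))) m (toEligible k c)
  }
  where
  fromEligible : ∀ k → Eligible (history k) m → Candidateℕ yellowstone k m
  fromEligible {m} k (0<m , m∉ , 1<g , g≡1) = record
    { positive = 0<m
    ; unused   = λ { i i<n refl →
        m∉ (subst (m ∈_) (sym (used-history k)) (∈-applyDownFrom⁺ yellowstone i<n)) }
    ; shares   = subst (λ x → 1 < gcd m x) (previous-history k) 1<g
    ; coprime  = g≡1
    }

  toEligible : ∀ k → Candidateℕ yellowstone k m → Eligible (history k) m
  toEligible {m} k c = positive , m∉ ,
      subst (λ x → 1 < gcd m x) (sym (previous-history k)) shares , coprime
    where
    open Candidateℕ c
    m∉ : m ∉ History.used (history k)
    m∉ m∈ with ∈-applyDownFrom⁻ yellowstone (subst (m ∈_) (used-history k) m∈)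
    ... | i , i<n , m≡ = unused i i<n m≡

-- Positive integers

≡pos : (x : ℕ⁺) → ∃[ n ] x ≡ pos (suc n)
≡pos (suc n , _) = n , refl
-- The `NonZero` proof is irrelevant, so the absurdity must be eliminated irrelevantly.
≡pos (zero , [ 0≢0 ]) = ⊥-elim-irr (≢-nonZero⁻¹ 0 {{0≢0}} refl)

value>0 : (x : ℕ⁺) → 0 < value x
value>0 x with ≡pos x
... | n , refl = s≤s z≤n

terms : (ℕ⁺ → ℕ⁺) → ℕ → ℕ
terms a n = value (a (pos (suc n)))

module _ {a : ℕ⁺ → ℕ⁺} where

  candidate⇒candidateℕ : ∀ k x → Candidate a k x → Candidateℕ (terms a) k (value x)
  candidate⇒candidateℕ k x c = record
    { positive = value>0 x
    ; unused   = λ i i<n eq → unused (pos (suc i)) (s≤s i<n) (value-injective eq)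
    ; shares   = shares
    ; coprime  = coprime
    }
    where open Candidate c

  candidateℕ⇒candidate : ∀ k x → Candidateℕ (terms a) k (value x) → Candidate a k x
  candidateℕ⇒candidate k x c = record
    { unused  = unused⁺
    ; shares  = shares
    ; coprime = coprime
    }
    where
    open Candidateℕ c
    unused⁺ : ∀ i → value i < 4 + k → x ≢ a i
    unused⁺ i i<4+k eq with ≡pos i
    unused⁺ i (s≤s j<3+k) eq | j , refl = unused j j<3+k (cong value eq)

  isYellowstone⇒isYellowstoneℕ : IsYellowstone a → IsYellowstoneℕ (terms a)
  isYellowstone⇒isYellowstoneℕ Y = record
    { first  = cong value first
    ; second = cong value second
    ; third  = cong value third
    ; next   = λ k → candidate⇒candidateℕ k (a (pos (4 + k))) (proj₁ (next k))
    ; smallest = λ k m c → let x = pos m {{>-nonZero (Candidateℕ.positive c)}} in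
        proj₂ (next k) x (candidateℕ⇒candidate k x c)
    }
    where open IsYellowstone Y

  isYellowstoneℕ⇒isYellowstone : IsYellowstoneℕ (terms a) → IsYellowstone a
  isYellowstoneℕ⇒isYellowstone Y = record
    { first  = value-injective first
    ; second = value-injective second
    ; third  = value-injective third
    ; next   = λ k → candidateℕ⇒candidate k (a (pos (4 + k))) (next k) ,
        λ x c → smallest k (value x) (candidate⇒candidateℕ k x c)
    }
    where open IsYellowstoneℕ Y

theorem1 : (∃[ a ] IsYellowstone a) ×
    (∀ (a : ℕ⁺ → ℕ⁺) → IsYellowstone a → Bijective _≡_ _≡_ a)
theorem1 = (yellowstone⁺ , isYellowstoneℕ⇒isYellowstone yellowstone-isYellowstone) , bijective
  where
  yellowstone⁺ : ℕ⁺ → ℕ⁺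
  -- `pred` undoes the index shift, so `terms yellowstone⁺ n` computes to `yellowstone n`.
  yellowstone⁺ x = pos (yellowstone (pred (value x)))
    {{>-nonZero (Yellowstone.positive yellowstone-isYellowstone (pred (value x)))}}

  bijective : ∀ a → IsYellowstone a → Bijective _≡_ _≡_ a
  bijective a Y = injective⁺ , surjective⁺
    where
    open Yellowstone (isYellowstone⇒isYellowstoneℕ Y)

    injective⁺ : ∀ {x y} → a x ≡ a y → x ≡ y
    injective⁺ {x} {y} ax≡ay with ≡pos x | ≡pos y
    ... | i , refl | j , refl with refl ← injective i j (cong value ax≡ay) = refl

    surjective⁺ : ∀ y → ∃[ x ] (∀ {z} → z ≡ x → a z ≡ y)
    surjective⁺ y with appears (value y) (value>0 y)
    ... | n , eq = pos (suc n) , λ { refl → value-injective eq }
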